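{- The axiomatic system $\mathbf{KB5}^\circ$ is sound and strongly complete with respect to the class of $\mathcal{S}5$-frames (frames whose accessibility relation is an equivalence relation). That is, with $F$ the class of such frames: every theorem of $\mathbf{KB5}^\circ$ is valid on $F$ (soundness), and for every set $\Gamma\cup\{\phi\}$ of $\mathcal{L}(\circ)$-formulas, if $\Gamma\vDash_F\phi$ then $\Gamma\vdash_{\mathbf{KB5}^\circ}\phi$ (strong completeness).
   Context: Let $\mathbf{P}$ be a set of propositional variables, with $p,q\in\mathbf{P}$ distinct. The language $\mathcal{L}(\circ)$ is given by $\phi::=r\mid\neg\phi\mid(\phi\land\phi)\mid\circ\phi$ with $r\in\mathbf{P}$; other Boolean connectives and $\top$ are the usual abbreviations. A frame is $\langle S,R\rangle$ with $S$ a nonempty set and $R\subseteq S\times S$ (the accessibility relation). A model based on a frame is $\mathcal{M}=\langle S,R,V\rangle$ with $V:\mathbf{P}\to\mathcal{P}(S)$. Satisfaction: $\mathcal{M},s\vDash r$ iff $s\in V(r)$; Booleans as usual; $\mathcal{M},s\vDash\circ\phi$ iff ($\mathcal{M},s\vDash\phi$ implies that $\mathcal{M},t\vDash\phi$ for all $t$ with $sRt$). For a class $F$ of frames, $\phi$ is valid on $F$ if $\mathcal{M},s\vDash\phi$ for every model $\mathcal{M}$ based on a frame in $F$ and every $s$ in $\mathcal{M}$; $\Gamma\vDash_F\phi$ means: for every model $\mathcal{M}$ based on a frame in $F$ and every $s$ in $\mathcal{M}$, if $\mathcal{M},s\vDash\gamma$ for all $\gamma\in\Gamma$ then $\mathcal{M},s\vDash\phi$.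 The system $\mathbf{K}^\circ$ has as axioms all propositional tautologies, $\circ\top$, $\neg p\to\circ p$, and $\circ p\land\circ q\to\circ(p\land q)$, and as inference rules uniform substitution, modus ponens, and the rule: from $\phi\to\psi$ infer $\circ\phi\land\phi\to\circ\psi$. The system $\mathbf{KB5}^\circ$ is $\mathbf{K}^\circ$ plus the axioms $p\to\circ(\circ\neg p\to p)$ and $\neg\circ\neg p\to\circ(\circ\neg p\to p)$. A derivation from $\Gamma$ to $\phi$ in a system, written $\Gamma\vdash\phi$ (with the system as subscript), is a finite sequence of $\mathcal{L}(\circ)$-formulas (ending in $\phi$) in which each formula is either an instantiation of an axiom, or an element of $\Gamma$, or the result of applying an inference rule to prior formulas in the sequence. A theorem is a formula $\phi$ for which there is a derivation from $\emptyset$ to $\phi$. -}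

module Defs where

open import Data.Bool.Base using (Bool; true; not) renaming (_∧_ to _&&_)
open import Data.List.Base using (List; []; _∷_)
open import Data.List.Membership.Propositional using (_∈_)
open import Data.Product.Base using (_×_; ∃-syntax)
open import Level using (Level; suc)
open import Relation.Binary.Core using (Rel)
open import Relation.Binary.PropositionalEquality.Core using (_≡_)
open import Relation.Binary.Structures using (IsEquivalence)
open import Relation.Nullary.Negation.Core using (¬_)
open import Relation.Unary using (Pred)
open import Relation.Unary.Polymorphic using (∅)

private
  variable
    ℓ : Level

infix  9 _[_]
infix  8 ∼_ ○_
infixr 7 _∧_
infixr 6 _⇒_

data Formula (P : Set ℓ) : Set ℓ where
  var : P → Formula P
  ∼_  : Formula P → Formula P
  _∧_ : Formula P → Formula P → Formula P
  ○_  : Formula P → Formula P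

_⇒_ : {P : Set ℓ} → Formula P → Formula P → Formula P
φ ⇒ ψ = ∼ (φ ∧ ∼ ψ)

-- There is no constant for truth, so the abbreviation needs some variable r.
verum : {P : Set ℓ} → P → Formula P
verum r = var r ⇒ var r

_[_] : {P : Set ℓ} → Formula P → (P → Formula P) → Formula P
var r   [ σ ] = σ r
(∼ φ)   [ σ ] = ∼ (φ [ σ ])
(φ ∧ ψ) [ σ ] = φ [ σ ] ∧ ψ [ σ ]
(○ φ)   [ σ ] = ○ (φ [ σ ])

record Frame (ℓ : Level) : Set (suc ℓ) where
  field
    S         : Set ℓ
    inhabited : S
    R         : Rel S ℓ

FrameClass : (ℓ : Level) → Set (suc ℓ)
FrameClass ℓ = Pred (Frame ℓ) ℓ

record Model (P : Set ℓ) : Set (suc ℓ) where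
  field
    frame : Frame ℓ
  open Frame frame public
  field
    V : P → Pred S ℓ

infix 4 _,_⊨_

_,_⊨_ : {P : Set ℓ} (M : Model P) → Model.S M → Formula P → Set ℓ
M , s ⊨ var r   = Model.V M r s
M , s ⊨ ∼ φ     = ¬ (M , s ⊨ φ)
M , s ⊨ (φ ∧ ψ) = (M , s ⊨ φ) × (M , s ⊨ ψ)
M , s ⊨ ○ φ     = M , s ⊨ φ → ∀ t → Model.R M s t → M , t ⊨ φ

Valid : {P : Set ℓ} → FrameClass ℓ → Formula P → Set (suc ℓ)
Valid {P = P} F φ =
  (M : Model P) → F (Model.frame M) → (s : Model.S M) → M , s ⊨ φ

Entails : {P : Set ℓ} → FrameClass ℓ → Pred (Formula P) ℓ → Formula P → Set (suc ℓ)
Entails {P = P} F Γ φ =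
  (M : Model P) → F (Model.frame M) → (s : Model.S M) →
  (∀ γ → Γ γ → M , s ⊨ γ) → M , s ⊨ φ

S5 : FrameClass ℓ
S5 F = IsEquivalence (Frame.R F)

-- Truth-table evaluation in which variables and formulas ○ φ are the atoms.
eval : {P : Set ℓ} → (Formula P → Bool) → Formula P → Bool
eval v (var r) = v (var r)
eval v (∼ φ)   = not (eval v φ)
eval v (φ ∧ ψ) = eval v φ && eval v ψ
eval v (○ φ)   = v (○ φ)

Tautology : {P : Set ℓ} → Pred (Formula P) ℓ
Tautology φ = ∀ v → eval v φ ≡ true

-- The axioms are single formulas in the fixed variables p and q; instantiation
-- happens inside derivations.
data K° {P : Set ℓ} (p q : P) : Pred (Formula P) ℓ where
  taut : ∀ {φ} → Tautology φ → K° p q φ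
  ○⊤   : K° p q (○ verum p)
  equi : K° p q (∼ var p ⇒ ○ var p)
  conj : K° p q ((○ var p ∧ ○ var q) ⇒ ○ (var p ∧ var q))

data KB5° {P : Set ℓ} (p q : P) : Pred (Formula P) ℓ where
  base : ∀ {φ} → K° p q φ → KB5° p q φ
  axB  : KB5° p q (var p ⇒ ○ (○ ∼ var p ⇒ var p))
  ax5  : KB5° p q (∼ ○ ∼ var p ⇒ ○ (○ ∼ var p ⇒ var p))

-- Admissible next entries of a derivation whose entries so far are `prior`.
-- All systems here share the same three inference rules, so a system is given
-- by its axioms.  The rules, uniform substitution included, apply to any
-- earlier entries, whether or not those depend on premises from Γ.
data Step {P : Set ℓ} (Ax Γ : Pred (Formula P) ℓ) (prior : List (Formula P)) :
          Pred (Formula P) ℓ where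
  axiom-instance : ∀ {α} → Ax α → (σ : P → Formula P) → Step Ax Γ prior (α [ σ ])
  premise        : ∀ {γ} → Γ γ → Step Ax Γ prior γ
  substitution   : ∀ {φ} → φ ∈ prior → (σ : P → Formula P) →
                   Step Ax Γ prior (φ [ σ ])
  modus-ponens   : ∀ {φ ψ} → (φ ⇒ ψ) ∈ prior → φ ∈ prior → Step Ax Γ prior ψ
  ○-rule         : ∀ {φ ψ} → (φ ⇒ ψ) ∈ prior →
                   Step Ax Γ prior ((○ φ ∧ φ) ⇒ ○ ψ)

-- Derivations are listed with the most recent entry first.
data Derivation {P : Set ℓ} (Ax Γ : Pred (Formula P) ℓ) :
                Pred (List (Formula P)) ℓ where
  []  : Derivation Ax Γ []
  _∷_ : ∀ {φ prior} → Step Ax Γ prior φ → Derivation Ax Γ prior →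
        Derivation Ax Γ (φ ∷ prior)

infix 4 _⊢[_]_

_⊢[_]_ : {P : Set ℓ} → Pred (Formula P) ℓ → Pred (Formula P) ℓ → Formula P → Set ℓ
Γ ⊢[ Ax ] φ = ∃[ prior ] Derivation Ax Γ (φ ∷ prior)

Theorem : {P : Set ℓ} → Pred (Formula P) ℓ → Pred (Formula P) ℓ
Theorem Ax φ = ∅ ⊢[ Ax ] φ

-- With □φ := ○φ ∧ φ and ◇φ := ∼ □ ∼ φ the axioms make □ an S5 modality, and ○φ is
-- provably equivalent to φ ⇒ □φ.  Since derivations may apply substitution to
-- premises, an unprovable φ stays unprovable after all variables foreign to φ are
-- identified with p, so only finitely many variables matter and neither Zorn's lemma
-- nor an enumeration of P is needed: the worlds of a countermodel are the state
-- descriptions a over these variables with ◇a implied by χ, where χ decides all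
-- formulas ◇a.  Truth of ψ at a then amounts to the derivability of χ ⇒ □ (a ⇒ ψ).
module Submission where

open import Defs
open import Axiom.ExcludedMiddle using (ExcludedMiddle)
open import Data.Bool.Base using (Bool; true; false; not; T) renaming (_∧_ to _&&_)
open import Data.Empty using (⊥-elim)
open import Data.List.Base using (List; []; _∷_; _++_; map)
open import Data.List.Membership.Propositional using (_∈_)
open import Data.List.Membership.Propositional.Properties
  using (∈-map⁺; ∈-map⁻; ∈-++⁺ˡ; ∈-++⁺ʳ; ∈-++⁻)
open import Data.List.Relation.Binary.Subset.Propositional using (_⊆_)
open import Data.List.Relation.Unary.All using (All; []; _∷_) renaming (lookup to All-lookup)
open import Data.List.Relation.Unary.Any using (here; there)
open import Data.Nat.Base using (ℕ; zero; suc)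
open import Data.Product.Base using (_×_; _,_; proj₁; proj₂; ∃-syntax; Σ-syntax; uncurry)
open import Data.Sum.Base using (_⊎_; inj₁; inj₂; [_,_]′)
open import Data.Unit.Polymorphic.Base using (⊤; tt)
open import Function.Base using (_∘_; id; case_of_)
open import Function.Bundles using (_⇔_; mk⇔; Equivalence)
open import Level using (Level)
open import Relation.Binary.PropositionalEquality.Core
  using (_≡_; _≢_; refl; cong; cong₂; subst; subst₂)
open import Relation.Binary.Structures using (IsEquivalence)
open import Relation.Nullary.Decidable.Core using (Dec; yes; no; does)
open import Relation.Nullary.Negation.Core using (¬_; contradiction)
open import Relation.Unary using (Pred)
open import Relation.Unary.Polymorphic using (∅)

open Equivalence using (to; from)

private
  variable
    ℓ : Level
    P : Set ℓ

-- Truth tables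

infixr 4 _⊃_

_⊃_ : Bool → Bool → Bool
a ⊃ b = not (a && not b)

BoolFun : ℕ → Set
BoolFun zero    = Bool
BoolFun (suc n) = Bool → BoolFun n

AllRows : ∀ n → BoolFun n → Set
AllRows zero    b = T b
AllRows (suc n) f = AllRows n (f true) × AllRows n (f false)

Everywhere : ∀ n → BoolFun n → Set
Everywhere zero    b = b ≡ true
Everywhere (suc n) f = ∀ b → Everywhere n (f b)

-- For a concrete valid `f`, `AllRows n f` reduces to a product of unit types, so the implicit
-- argument is solved by eta. Checking a tautology then only requires naming the values of its
-- parts.
truth-table : ∀ n (f : BoolFun n) {_ : AllRows n f} → Everywhere n f
truth-table zero    true            = refl
truth-table (suc n) f {t , _} true  = truth-table n (f true) {t}
truth-table (suc n) f {_ , t} false = truth-table n (f false) {t}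

-- Substitution

vars : Formula P → List P
vars (var r) = r ∷ []
vars (∼ φ)   = vars φ
vars (φ ∧ ψ) = vars φ ++ vars ψ
vars (○ φ)   = vars φ

[]-fixed : (φ : Formula P) {σ : P → Formula P} →
           (∀ {r} → r ∈ vars φ → σ r ≡ var r) → φ [ σ ] ≡ φ
[]-fixed (var r) e = e (here refl)
[]-fixed (∼ φ)   e = cong ∼_ ([]-fixed φ e)
[]-fixed (φ ∧ ψ) e =
  cong₂ _∧_ ([]-fixed φ (e ∘ ∈-++⁺ˡ)) ([]-fixed ψ (e ∘ ∈-++⁺ʳ (vars φ)))
[]-fixed (○ φ)   e = cong ○_ ([]-fixed φ e)

-- Soundness

module _ (em : ExcludedMiddle ℓ) {P : Set ℓ} where

  -- `_⇒_` abbreviates a negated conjunction, so its truth yields a function only classically.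
  ⇒-elim : {A B : Set ℓ} → ¬ (A × ¬ B) → A → B
  ⇒-elim {B = B} f a with em {B}
  ... | yes b = b
  ... | no ¬b = ⊥-elim (f (a , ¬b))

  truth : (M : Model P) → Model.S M → Formula P → Bool
  truth M s φ = does (em {M , s ⊨ φ})

  does-em : {A : Set ℓ} → (does (em {A}) ≡ true) ⇔ A
  does-em {A} with em {A}
  ... | yes a = mk⇔ (λ _ → a) (λ _ → refl)
  ... | no ¬a = mk⇔ (λ ()) (λ a → contradiction a ¬a)

  -- Truth at a world is itself a Boolean valuation of the atoms; hence every tautology is true
  -- there.
  eval-truth : (M : Model P) (s : Model.S M) (φ : Formula P) →
               (eval (truth M s) φ ≡ true) ⇔ (M , s ⊨ φ)
  eval-truth M s (var r) = does-em
  eval-truth M s (∼ φ) with eval (truth M s) φ | eval-truth M s φ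
  ... | true  | e = mk⇔ (λ ()) (λ ¬h → contradiction (to e refl) ¬h)
  ... | false | e = mk⇔ (λ _ h → case from e h of λ ()) (λ _ → refl)
  eval-truth M s (φ ∧ ψ)
    with eval (truth M s) φ | eval-truth M s φ
  ... | true  | e = mk⇔ (λ h → to e refl , to (eval-truth M s ψ) h)
                        (from (eval-truth M s ψ) ∘ proj₂)
  ... | false | e = mk⇔ (λ ()) (from e ∘ proj₁)
  eval-truth M s (○ φ) = does-em

  substituted : Model P → (P → Formula P) → Model P
  substituted M σ = record
    { frame = Model.frame M
    ; V     = λ r s → M , s ⊨ σ r
    }

  ⊨-[] : (M : Model P) (σ : P → Formula P) (s : Model.S M) (φ : Formula P) →
         (substituted M σ , s ⊨ φ) ⇔ (M , s ⊨ φ [ σ ])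
  ⊨-[] M σ s (var r) = mk⇔ id id
  ⊨-[] M σ s (∼ φ)   = mk⇔ (_∘ from e) (_∘ to e)
    where e = ⊨-[] M σ s φ
  ⊨-[] M σ s (φ ∧ ψ) = mk⇔ (λ (h , k) → to e h , to f k) (λ (h , k) → from e h , from f k)
    where
    e = ⊨-[] M σ s φ
    f = ⊨-[] M σ s ψ
  ⊨-[] M σ s (○ φ)   =
    mk⇔ (λ h k t r → to   (⊨-[] M σ t φ) (h (from (⊨-[] M σ s φ) k) t r))
        (λ h k t r → from (⊨-[] M σ t φ) (h (to   (⊨-[] M σ s φ) k) t r))

  -- Substitution is absorbed into the valuation and leaves the frame alone, so the model stays over
  -- the given class.
  Valid-[] : {F : FrameClass ℓ} {φ : Formula P} → Valid F φ →
             (σ : P → Formula P) → Valid F (φ [ σ ])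
  Valid-[] {φ = φ} h σ M F s = to (⊨-[] M σ s φ) (h (substituted M σ) F s)

  axiom-valid : {p q : P} {α : Formula P} → KB5° p q α → Valid S5 α
  axiom-valid (base (taut {φ} h)) M _ s = to (eval-truth M s φ) (h (truth M s))
  axiom-valid (base ○⊤)   M _ s _ t _ = uncurry λ h ¬h → ¬h h
  axiom-valid (base equi) M _ s (¬h , ¬○) = ¬○ λ h → contradiction h ¬h
  axiom-valid (base conj) M _ s ((f , g) , ¬○) =
    ¬○ λ (h , k) t r → f h t r , g k t r
  -- If `p` fails at `t`, then `○ ∼ p` at `t` would carry `∼ p` back to `s` along the reversed edge.
  axiom-valid axB M E s (h , ¬○) =
    ¬○ λ _ t r (f , ¬k) → f ¬k s (IsEquivalence.sym E r) h
  -- Every successor `u` of `s` is also seen from `t`, so `○ ∼ p` and `∼ p` at `t` would force `∼ p`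
  -- at all of them.
  axiom-valid ax5 M E s (¬h , ¬○) =
    ¬○ λ _ t r (f , ¬k) → ¬h λ _ u r′ →
      f ¬k u (IsEquivalence.trans E (IsEquivalence.sym E r) r′)

  -- The invariant is validity rather than truth at one world, since substitution appeals to other
  -- models and the `○`-rule to other worlds.
  step-valid : {p q : P} {prior : List (Formula P)} {φ : Formula P} →
               All (Valid S5) prior → Step (KB5° p q) ∅ prior φ → Valid S5 φ
  step-valid vs (axiom-instance {α} a σ) = Valid-[] {φ = α} (axiom-valid a) σ
  step-valid vs (substitution {φ} i σ)   = Valid-[] {φ = φ} (All-lookup vs i) σ
  step-valid vs (modus-ponens i j) M E s =
    ⇒-elim (All-lookup vs i M E s) (All-lookup vs j M E s)
  step-valid vs (○-rule i) M E s ((f , h) , ¬○) =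
    ¬○ λ _ t r → ⇒-elim (All-lookup vs i M E t) (f h t r)

  derivation-valid : {p q : P} {l : List (Formula P)} →
                     Derivation (KB5° p q) ∅ l → All (Valid S5) l
  derivation-valid []      = []
  derivation-valid (s ∷ d) = step-valid (derivation-valid d) s ∷ derivation-valid d

-- Derivations

module _ {P : Set ℓ} {Ax Γ : Pred (Formula P) ℓ} where

  step-⊆ : {l m : List (Formula P)} {φ : Formula P} → l ⊆ m → Step Ax Γ l φ → Step Ax Γ m φ
  step-⊆ i (axiom-instance a σ) = axiom-instance a σ
  step-⊆ i (premise g)          = premise g
  step-⊆ i (substitution j σ)   = substitution (i j) σ
  step-⊆ i (modus-ponens j k)   = modus-ponens (i j) (i k)
  step-⊆ i (○-rule j)           = ○-rule (i j)

  append : {l m : List (Formula P)} →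
           Derivation Ax Γ l → Derivation Ax Γ m → Derivation Ax Γ (l ++ m)
  append []      e = e
  append (s ∷ d) e = step-⊆ ∈-++⁺ˡ s ∷ append d e

  ⊢-axiom : {α : Formula P} → Ax α → (σ : P → Formula P) → Γ ⊢[ Ax ] α [ σ ]
  ⊢-axiom a σ = [] , axiom-instance a σ ∷ []

  ⊢-premise : {γ : Formula P} → Γ γ → Γ ⊢[ Ax ] γ
  ⊢-premise g = [] , premise g ∷ []

  ⊢-[] : {φ : Formula P} → Γ ⊢[ Ax ] φ → (σ : P → Formula P) → Γ ⊢[ Ax ] φ [ σ ]
  ⊢-[] (l , d) σ = _ , substitution (here refl) σ ∷ d

  ⊢-mp : {φ ψ : Formula P} → Γ ⊢[ Ax ] φ ⇒ ψ → Γ ⊢[ Ax ] φ → Γ ⊢[ Ax ] ψ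
  ⊢-mp {φ} {ψ} (l , d) (m , e) =
    _ , modus-ponens (here refl) (∈-++⁺ʳ (φ ⇒ ψ ∷ l) (here refl)) ∷ append d e

  ⊢-○ : {φ ψ : Formula P} → Γ ⊢[ Ax ] φ ⇒ ψ → Γ ⊢[ Ax ] (○ φ ∧ φ) ⇒ ○ ψ
  ⊢-○ (l , d) = _ , ○-rule (here refl) ∷ d

-- State descriptions

cells : P → List (Formula P) → List (Formula P)
cells p []      = verum p ∷ []
cells p (ψ ∷ l) = map (ψ ∧_) (cells p l) ++ map (∼ ψ ∧_) (cells p l)

-- Kept abstract because it is used twice: for derivability, and in `Boxed` for necessity under `χ`.
module PropositionalTheory
  {P : Set ℓ} (Th : Pred (Formula P) ℓ)
  (tautology : ∀ {φ} → Tautology φ → Th φ)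
  (mp : ∀ {φ ψ} → Th (φ ⇒ ψ) → Th φ → Th ψ) where

  infer₁ : ∀ {φ ψ} → Th φ → Tautology (φ ⇒ ψ) → Th ψ
  infer₁ h t = mp (tautology t) h

  infer₂ : ∀ {φ ψ θ} → Th φ → Th ψ → Tautology (φ ⇒ ψ ⇒ θ) → Th θ
  infer₂ h k t = mp (infer₁ h t) k

  weaken : ∀ χ {φ} → Th φ → Th (χ ⇒ φ)
  weaken χ {φ} h = infer₁ h λ v → truth-table 2 (λ a b → a ⊃ b ⊃ a) (eval v φ) (eval v χ)

  ⇒-mp : ∀ χ {φ ψ} → Th (χ ⇒ φ ⇒ ψ) → Th (χ ⇒ φ) → Th (χ ⇒ ψ)
  ⇒-mp χ {φ} {ψ} h k = infer₂ h k λ v →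
    truth-table 3 (λ a b c → (a ⊃ b ⊃ c) ⊃ (a ⊃ b) ⊃ a ⊃ c) (eval v χ) (eval v φ) (eval v ψ)

  ⇒-trans : ∀ {φ ψ θ} → Th (φ ⇒ ψ) → Th (ψ ⇒ θ) → Th (φ ⇒ θ)
  ⇒-trans {φ} {ψ} {θ} h k = infer₂ h k λ v →
    truth-table 3 (λ a b c → (a ⊃ b) ⊃ (b ⊃ c) ⊃ a ⊃ c) (eval v φ) (eval v ψ) (eval v θ)

  contrapose : ∀ {φ ψ} → Th (φ ⇒ ψ) → Th (∼ ψ ⇒ ∼ φ)
  contrapose {φ} {ψ} h = infer₁ h λ v →
    truth-table 2 (λ a b → (a ⊃ b) ⊃ not b ⊃ not a) (eval v φ) (eval v ψ)

  -- The cells `ψ ∧ c` and `∼ ψ ∧ c` jointly exhaust `c`, so the splits are undone one formula at a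
  -- time until only truth is left as antecedent.
  cells-cover : ∀ p l {θ} → (∀ {c} → c ∈ cells p l → Th (c ⇒ θ)) → Th θ
  cells-cover p []      {θ} h = infer₁ (h (here refl)) λ v →
    truth-table 2 (λ a b → ((a ⊃ a) ⊃ b) ⊃ b) (v (var p)) (eval v θ)
  cells-cover p (ψ ∷ l) {θ} h = cells-cover p l λ {c} i →
    infer₂ (h (∈-++⁺ˡ (∈-map⁺ (ψ ∧_) i)))
           (h (∈-++⁺ʳ (map (ψ ∧_) (cells p l)) (∈-map⁺ (∼ ψ ∧_) i)))
      λ v → truth-table 3 (λ a b c → (a && b ⊃ c) ⊃ (not a && b ⊃ c) ⊃ b ⊃ c)
              (eval v ψ) (eval v c) (eval v θ)

  ∧-projˡ : ∀ φ ψ → Th (φ ∧ ψ ⇒ φ)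
  ∧-projˡ φ ψ = tautology λ v → truth-table 2 (λ a b → a && b ⊃ a) (eval v φ) (eval v ψ)

  ∧-projʳ : ∀ φ ψ → Th (φ ∧ ψ ⇒ ψ)
  ∧-projʳ φ ψ = tautology λ v → truth-table 2 (λ a b → a && b ⊃ b) (eval v φ) (eval v ψ)

  -- Each listed formula occurs in the cell as a conjunct, plain or negated.
  cells-decide : ∀ p l {c ψ} → c ∈ cells p l → ψ ∈ l → Th (c ⇒ ψ) ⊎ Th (c ⇒ ∼ ψ)
  cells-decide p (ψ ∷ l) i j with ∈-++⁻ (map (ψ ∧_) (cells p l)) i
  cells-decide p (ψ ∷ l) i j | inj₁ i′ with ∈-map⁻ (ψ ∧_) i′
  cells-decide p (ψ ∷ l) i (here refl) | inj₁ i′ | c , _ , refl = inj₁ (∧-projˡ ψ c)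
  cells-decide p (ψ ∷ l) i (there j)   | inj₁ i′ | c , k , refl =
    [ inj₁ ∘ ⇒-trans (∧-projʳ ψ c) , inj₂ ∘ ⇒-trans (∧-projʳ ψ c) ]′ (cells-decide p l k j)
  cells-decide p (ψ ∷ l) i j | inj₂ i′ with ∈-map⁻ (∼ ψ ∧_) i′
  cells-decide p (ψ ∷ l) i (here refl) | inj₂ i′ | c , _ , refl = inj₂ (∧-projˡ (∼ ψ) c)
  cells-decide p (ψ ∷ l) i (there j)   | inj₂ i′ | c , k , refl =
    [ inj₁ ∘ ⇒-trans (∧-projʳ (∼ ψ) c) , inj₂ ∘ ⇒-trans (∧-projʳ (∼ ψ) c) ]′
      (cells-decide p l k j)

-- The S5 modality

infix 8 □_

□_ : Formula P → Formula P
□ φ = ○ φ ∧ φ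

module Completeness (em : ExcludedMiddle ℓ) {P : Set ℓ} {p q : P} (p≢q : p ≢ q)
                    (Γ : Pred (Formula P) ℓ) where

  infix 4 ⊢_

  ⊢_ : Pred (Formula P) ℓ
  ⊢ φ = Γ ⊢[ KB5° p q ] φ

  ⊢-tautology : ∀ {φ} → Tautology φ → ⊢ φ
  ⊢-tautology {φ} t =
    subst ⊢_ ([]-fixed φ λ _ → refl) (⊢-axiom (base (taut {φ = φ} t)) var)

  open PropositionalTheory ⊢_ ⊢-tautology ⊢-mp

  -- The axiom `conj` is a single formula in `p` and `q`, so an arbitrary instance needs one
  -- substitution replacing both; `p ≢ q` makes this possible.
  pair : Formula P → Formula P → P → Formula P
  pair φ ψ r with em {p ≡ r}
  ... | yes _ = φ
  ... | no _  = ψ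

  pair-p : ∀ φ ψ → pair φ ψ p ≡ φ
  pair-p φ ψ with em {p ≡ p}
  ... | yes _   = refl
  ... | no p≢p = contradiction refl p≢p

  pair-q : ∀ φ ψ → pair φ ψ q ≡ ψ
  pair-q φ ψ with em {p ≡ q}
  ... | yes p≡q = contradiction p≡q p≢q
  ... | no _    = refl

  ⊢equi : ∀ φ → ⊢ ∼ φ ⇒ ○ φ
  ⊢equi φ = ⊢-axiom (base equi) (λ _ → φ)

  ⊢conj : ∀ φ ψ → ⊢ (○ φ ∧ ○ ψ) ⇒ ○ (φ ∧ ψ)
  ⊢conj φ ψ = subst₂ (λ α β → ⊢ (○ α ∧ ○ β) ⇒ ○ (α ∧ β)) (pair-p φ ψ) (pair-q φ ψ)
                (⊢-axiom (base conj) (pair φ ψ))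

  □-mono : ∀ {φ ψ} → ⊢ φ ⇒ ψ → ⊢ □ φ ⇒ □ ψ
  □-mono {φ} {ψ} h = infer₂ h (⊢-○ h) λ v →
    truth-table 4 (λ a b c d → (a ⊃ b) ⊃ (c && a ⊃ d) ⊃ c && a ⊃ d && b)
      (eval v φ) (eval v ψ) (v (○ φ)) (v (○ ψ))

  -- A derivable `φ` follows from truth, which `○⊤` makes necessary, and monotonicity passes the box
  -- on. Since `⊢` admits premises, these become necessary as well.
  necessitation : ∀ {φ} → ⊢ φ → ⊢ □ φ
  necessitation {φ} h = ⊢-mp (□-mono (weaken (verum p) h)) □verum
    where
    □verum : ⊢ □ verum p
    □verum = infer₁ (⊢-axiom (base ○⊤) var) λ v →
      truth-table 2 (λ a b → a ⊃ a && (b ⊃ b)) (v (○ verum p)) (v (var p))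

  □-distrib : ∀ φ ψ → ⊢ □ (φ ⇒ ψ) ⇒ □ φ ⇒ □ ψ
  □-distrib φ ψ = infer₂ (⊢conj (φ ⇒ ψ) φ) (□-mono modus) λ v →
    truth-table 6
      (λ a b c d e f → (d && e ⊃ c) ⊃ (c && (a ⊃ b) && a ⊃ f && b) ⊃
                       d && (a ⊃ b) ⊃ e && a ⊃ f && b)
      (eval v φ) (eval v ψ) (v (○ ((φ ⇒ ψ) ∧ φ))) (v (○ (φ ⇒ ψ))) (v (○ φ)) (v (○ ψ))
    where
    modus : ⊢ (φ ⇒ ψ) ∧ φ ⇒ ψ
    modus = ⊢-tautology λ v → truth-table 2 (λ a b → (a ⊃ b) && a ⊃ b) (eval v φ) (eval v ψ)

  -- `∼ □ ∼ φ` is literally `○ ∼ φ ⇒ φ`. It holds because `φ` does or because `○ ∼ φ` fails; `axB`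
  -- handles the first case and `ax5` the second.
  ◇-□◇ : ∀ φ → ⊢ ∼ □ ∼ φ ⇒ □ (∼ □ ∼ φ)
  ◇-□◇ φ = infer₂ (⊢-axiom axB (λ _ → φ)) (⊢-axiom ax5 (λ _ → φ)) λ v →
    truth-table 3 (λ a b c → (a ⊃ c) ⊃ (not b ⊃ c) ⊃ (b ⊃ a) ⊃ c && (b ⊃ a))
      (eval v φ) (v (○ ∼ φ)) (v (○ (○ ∼ φ ⇒ φ)))

  ∼□-□∼□ : ∀ φ → ⊢ ∼ □ φ ⇒ □ (∼ □ φ)
  ∼□-□∼□ φ =
    ⇒-trans (contrapose (□-mono ∼∼-elim))
      (⇒-trans (◇-□◇ (∼ φ)) (□-mono (contrapose (□-mono ∼∼-intro))))
    where
    ∼∼-intro : ⊢ φ ⇒ ∼ ∼ φ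
    ∼∼-intro = ⊢-tautology λ v → truth-table 1 (λ a → a ⊃ not (not a)) (eval v φ)
    ∼∼-elim : ⊢ ∼ ∼ φ ⇒ φ
    ∼∼-elim = ⊢-tautology λ v → truth-table 1 (λ a → not (not a) ⊃ a) (eval v φ)

  -- The usual derivation of axiom 4 from T and 5: `□ φ` gives ◇□φ, hence □◇□φ, and the inner ◇□φ
  -- collapses to `□ φ`.
  □-□□ : ∀ φ → ⊢ □ φ ⇒ □ (□ φ)
  □-□□ φ = ⇒-trans □-◇□ (⇒-trans (◇-□◇ (□ φ)) (□-mono ◇□-□))
    where
    □-◇□ : ⊢ □ φ ⇒ ∼ □ (∼ □ φ)
    □-◇□ = ⊢-tautology λ v →
      truth-table 3 (λ a b c → a && b ⊃ not (c && not (a && b)))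
        (v (○ φ)) (eval v φ) (v (○ ∼ □ φ))
    ◇□-□ : ⊢ ∼ □ (∼ □ φ) ⇒ □ φ
    ◇□-□ = infer₁ (∼□-□∼□ φ) λ v →
      truth-table 3 (λ a b c → (not (a && b) ⊃ c && not (a && b)) ⊃
                               not (c && not (a && b)) ⊃ a && b)
        (v (○ φ)) (eval v φ) (v (○ ∼ □ φ))

  -- Countermodels built from state descriptions

  module Canonical (rs : List P) (p∈ : p ∈ rs) where

    collapse : (r : P) → Dec (r ∈ rs) → P
    collapse r (yes _) = r
    collapse r (no _)  = p

    collapse-∈ : (r : P) (d : Dec (r ∈ rs)) → collapse r d ∈ rs
    collapse-∈ r (yes i) = i
    collapse-∈ r (no _)  = p∈

    σ : P → Formula P
    σ r = var (collapse r em)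

    σ-fixed : ∀ {r} → r ∈ rs → σ r ≡ var r
    σ-fixed {r} i with em {r ∈ rs}
    ... | yes _ = refl
    ... | no ∉  = contradiction i ∉

    descriptions : List (Formula P)
    descriptions = cells p (map var rs)

    clusters : List (Formula P)
    clusters = cells p (map (λ a → □ ∼ a) descriptions)

    module Cluster {χ : Formula P} (χ∈ : χ ∈ clusters) where

      ⊢χ□ : Pred (Formula P) ℓ
      ⊢χ□ ψ = ⊢ χ ⇒ □ ψ

      theorem-□ : ∀ {ψ} → ⊢ ψ → ⊢χ□ ψ
      theorem-□ = weaken χ ∘ necessitation

      ⇒□-mp : ∀ {φ ψ} → ⊢χ□ (φ ⇒ ψ) → ⊢χ□ φ → ⊢χ□ ψ
      ⇒□-mp {φ} {ψ} h = ⇒-mp χ (⇒-trans h (□-distrib φ ψ))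

      module Boxed = PropositionalTheory ⊢χ□ (theorem-□ ∘ ⊢-tautology) ⇒□-mp

      possible? : ∀ {a} → a ∈ descriptions → ⊢χ□ (∼ a) ⊎ (⊢ χ ⇒ ∼ □ ∼ a)
      possible? i = cells-decide p (map (λ a → □ ∼ a) descriptions) χ∈ (∈-map⁺ _ i)

      World : Set ℓ
      World = Σ[ a ∈ Formula P ] a ∈ descriptions × (⊢ χ ⇒ ∼ □ ∼ a)

      model : (w : World) → Model P
      model w = record
        { frame = record { S = World ; inhabited = w ; R = λ _ _ → ⊤ }
        -- Variables outside `rs` receive the value of `p`, so that truth of `ψ` corresponds to
        -- `ψ [ σ ]`.
        ; V     = λ r (a , _) → ⊢ a ⇒ σ r
        }

      module _ (w₀ : World) where

        M : Model P
        M = model w₀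

        -- Under `χ`, `□ ψ` together with `□ (ψ ⇒ ∼ b)` would give `□ ∼ b`, against the possibility
        -- of `b`. So `χ` refutes `□ ψ`, necessarily so by negative introspection, and wherever `ψ`
        -- holds `∼ □ ψ` amounts to `∼ ○ ψ`.
        refutable : ∀ {a b ψ} → ⊢χ□ (b ⇒ ∼ ψ) → ⊢ χ ⇒ ∼ □ ∼ b → ⊢χ□ (a ⇒ ψ) → ⊢χ□ (a ⇒ ∼ ○ ψ)
        refutable {a} {b} {ψ} h ◇b k =
          Boxed.infer₂ k (⇒-trans χ⇒∼□ψ (∼□-□∼□ ψ)) λ v →
            truth-table 3 (λ a b c → (a ⊃ b) ⊃ not (c && b) ⊃ a ⊃ not c)
              (eval v a) (eval v ψ) (v (○ ψ))
          where
          ψ⇒∼b : ⊢χ□ (ψ ⇒ ∼ b)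
          ψ⇒∼b = Boxed.infer₁ h λ v →
            truth-table 2 (λ a b → (a ⊃ not b) ⊃ b ⊃ not a) (eval v b) (eval v ψ)
          χ⇒∼□ψ : ⊢ χ ⇒ ∼ □ ψ
          χ⇒∼□ψ = infer₂ (⇒-trans ψ⇒∼b (□-distrib ψ (∼ b))) ◇b λ v →
            truth-table 3 (λ a b c → (a ⊃ b ⊃ c) ⊃ (a ⊃ not c) ⊃ a ⊃ not b)
              (eval v χ) (eval v (□ ψ)) (eval v (□ ∼ b))

        -- Both outcomes carry a derivation, because the cases of `∼` and `○` need the negation of a
        -- false formula derived, which underivability alone would not supply.
        truth-lemma : ∀ ψ (w : World) →
          ((M , w ⊨ ψ) × ⊢χ□ (proj₁ w ⇒ ψ [ σ ])) ⊎
          (¬ (M , w ⊨ ψ) × ⊢χ□ (proj₁ w ⇒ ∼ (ψ [ σ ])))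
        truth-lemma (var r) (a , i , ◇a) with em {⊢ a ⇒ σ r}
        ... | yes h = inj₁ (h , theorem-□ h)
        ... | no ¬h = inj₂ (¬h , theorem-□ a⇒∼r)
          where
          a⇒∼r : ⊢ a ⇒ ∼ σ r
          -- `σ r` is always a variable from `rs`, hence decided by the description `a`.
          a⇒∼r = [ (λ h → contradiction h ¬h) , id ]′
            (cells-decide p (map var rs) i (∈-map⁺ var (collapse-∈ r em)))
        truth-lemma (∼ ψ) w@(a , _) with truth-lemma ψ w
        ... | inj₁ (h , k)  = inj₂ ((λ ¬h → ¬h h) , Boxed.infer₁ k λ v →
          truth-table 2 (λ a b → (a ⊃ b) ⊃ a ⊃ not (not b)) (eval v a) (eval v (ψ [ σ ])))
        ... | inj₂ (¬h , k) = inj₁ (¬h , k)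
        truth-lemma (φ ∧ ψ) w@(a , _) with truth-lemma φ w | truth-lemma ψ w
        ... | inj₁ (h , k) | inj₁ (h′ , k′) = inj₁ ((h , h′) , Boxed.infer₂ k k′ λ v →
          truth-table 3 (λ a b c → (a ⊃ b) ⊃ (a ⊃ c) ⊃ a ⊃ b && c)
            (eval v a) (eval v (φ [ σ ])) (eval v (ψ [ σ ])))
        ... | inj₂ (¬h , k) | _ =
          inj₂ (¬h ∘ proj₁ , Boxed.⇒-trans k (Boxed.contrapose (Boxed.∧-projˡ _ _)))
        ... | inj₁ _ | inj₂ (¬h , k) =
          inj₂ (¬h ∘ proj₂ , Boxed.⇒-trans k (Boxed.contrapose (Boxed.∧-projʳ _ _)))
        truth-lemma (○ ψ) w@(a , _) with truth-lemma ψ w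
        -- Where `ψ` is false, `○ ψ` is vacuously true, which is what the axiom `equi` expresses.
        ... | inj₂ (¬h , k) =
          inj₁ ((λ h → contradiction h ¬h) , Boxed.⇒-trans k (theorem-□ (⊢equi (ψ [ σ ]))))
        ... | inj₁ (h , k) with em {∃[ u ] ¬ (M , u ⊨ ψ)}
        ...   | yes (u@(b , _ , ◇b) , ¬hᵤ) =
          inj₂ ((λ ○h → ¬hᵤ (○h h u tt)) , refutable (refuted (truth-lemma ψ u)) ◇b k)
          where
          refuted : ((M , u ⊨ ψ) × ⊢χ□ (b ⇒ ψ [ σ ])) ⊎
                    (¬ (M , u ⊨ ψ) × ⊢χ□ (b ⇒ ∼ (ψ [ σ ]))) → ⊢χ□ (b ⇒ ∼ (ψ [ σ ]))
          refuted (inj₁ (hᵤ , _)) = contradiction hᵤ ¬hᵤ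
          refuted (inj₂ (_ , kᵤ)) = kᵤ
        ...   | no ∄u = inj₁ ((λ _ u _ → proj₁ (everywhere u)) , Boxed.weaken a χ□○ψ)
          where
          everywhere : (u : World) → (M , u ⊨ ψ) × ⊢χ□ (proj₁ u ⇒ ψ [ σ ])
          everywhere u with truth-lemma ψ u
          ... | inj₁ hk       = hk
          ... | inj₂ (¬h , _) = contradiction (u , ¬h) ∄u
          -- Descriptions that are not possible are excluded by `χ` under the box, the others are
          -- worlds and force `ψ`, and together they are exhaustive.
          χ□ψ : ⊢χ□ (ψ [ σ ])
          χ□ψ = Boxed.cells-cover p (map var rs) λ {b} i → case possible? i of λ where
            (inj₁ □∼b) → Boxed.infer₁ □∼b λ v →
              truth-table 2 (λ a b → not a ⊃ a ⊃ b) (eval v b) (eval v (ψ [ σ ]))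
            (inj₂ ◇b)  → proj₂ (everywhere (b , i , ◇b))
          χ□○ψ : ⊢χ□ (○ (ψ [ σ ]))
          χ□○ψ = ⇒□-mp (theorem-□ (∧-projˡ _ _)) (⇒-trans χ□ψ (□-□□ (ψ [ σ ])))

  -- Strong completeness

  unprovable-cell : ∀ l {θ} → ¬ (⊢ θ) → ∃[ c ] c ∈ cells p l × ¬ (⊢ c ⇒ θ)
  unprovable-cell l {θ} ⊬θ with em {∃[ c ] c ∈ cells p l × ¬ (⊢ c ⇒ θ)}
  ... | yes c = c
  ... | no ∄c = contradiction (cells-cover p l provable) ⊬θ
    where
    provable : ∀ {c} → c ∈ cells p l → ⊢ c ⇒ θ
    provable {c} i with em {⊢ c ⇒ θ}
    ... | yes h = h
    ... | no ⊬  = contradiction (c , i , ⊬) ∄c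

  completeness : (φ : Formula P) → Entails S5 Γ φ → ⊢ φ
  completeness φ Γ⊨φ with em {⊢ φ}
  ... | yes ⊢φ = ⊢φ
  -- `p` joins the variables of `φ` as the target onto which foreign variables are collapsed.
  ... | no ⊬φ with unprovable-cell (map var (p ∷ vars φ)) ⊬φ
  ...   | a , a∈ , a⊬φ
      -- The cluster is chosen after `a`, so that `χ` still fails to prove `a ⇒ φ`.
      with unprovable-cell (map (λ a → □ ∼ a) (cells p (map var (p ∷ vars φ)))) a⊬φ
  ...     | χ , χ∈ , χ⊬ = contradiction ⊢χaφ χ⊬
    where
    open Canonical (p ∷ vars φ) (here refl)
    open Cluster χ∈

    at-a : ∀ {ψ} → ⊢χ□ (a ⇒ ψ) → ⊢ χ ⇒ a ⇒ ψ
    at-a h = ⇒-trans h (∧-projʳ _ _)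

    explode : ∀ {ψ} → ⊢ ψ → ⊢ χ ⇒ a ⇒ ∼ ψ → ⊢ χ ⇒ a ⇒ φ
    explode {ψ} h k = infer₂ h k λ v →
      truth-table 4 (λ x a b c → b ⊃ (x ⊃ a ⊃ not b) ⊃ x ⊃ a ⊃ c)
        (eval v χ) (eval v a) (eval v ψ) (eval v φ)

    χ⇒◇a : ⊢ χ ⇒ ∼ □ ∼ a
    χ⇒◇a with possible? a∈
    ... | inj₂ ◇a  = ◇a
    -- Were `a` excluded, T would give `∼ a` under `χ`, and `a ⇒ φ` would follow trivially.
    ... | inj₁ □∼a = contradiction χ⇒a⇒φ χ⊬
      where
      χ⇒a⇒φ : ⊢ χ ⇒ a ⇒ φ
      χ⇒a⇒φ = infer₁ (⇒-trans □∼a (∧-projʳ _ _)) λ v →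
        truth-table 3 (λ x a b → (x ⊃ not a) ⊃ x ⊃ a ⊃ b) (eval v χ) (eval v a) (eval v φ)

    w : World
    w = a , a∈ , χ⇒◇a

    -- Substitution applies to premises, so `γ [ σ ]` is derivable outright; refuting it at `a`
    -- would let `χ` and `a` imply everything, `φ` included.
    satisfies-Γ : ∀ γ → Γ γ → model w , w ⊨ γ
    satisfies-Γ γ γ∈ with truth-lemma w γ w
    ... | inj₁ (h , _) = h
    ... | inj₂ (_ , k) = contradiction (explode (⊢-[] (⊢-premise γ∈) σ) (at-a k)) χ⊬

    φσ≡φ : φ [ σ ] ≡ φ
    φσ≡φ = []-fixed φ (σ-fixed ∘ there)

    ⊢χaφ : ⊢ χ ⇒ a ⇒ φ
    ⊢χaφ with truth-lemma w φ w
    ... | inj₁ (_ , k)  = subst (λ ψ → ⊢ χ ⇒ a ⇒ ψ) φσ≡φ (at-a k)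
    ... | inj₂ (¬h , _) = contradiction (Γ⊨φ (model w) S5-frame w satisfies-Γ) ¬h
      where
      S5-frame : IsEquivalence {A = World} (λ _ _ → ⊤)
      S5-frame = record { refl = tt ; sym = λ _ → tt ; trans = λ _ _ → tt }

theorem43 : ∀ {ℓ} → ExcludedMiddle ℓ → (P : Set ℓ) (p q : P) → p ≢ q →
    ((φ : Formula P) → Theorem (KB5° p q) φ → Valid S5 φ) ×
    ((Γ : Pred (Formula P) ℓ) (φ : Formula P) → Entails S5 Γ φ → Γ ⊢[ KB5° p q ] φ)
theorem43 em P p q p≢q =
  (λ φ (_ , d) → All-lookup (derivation-valid em d) (here refl)) ,
  (λ Γ → Completeness.completeness em p≢q Γ)
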